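{- Let $S$ be a nonempty finite set of integers with $\max S = m$. Then $S$ is an admissible pinnacle set if and only if both of the following hold: (1) $S\setminus\{m\}$ is an admissible pinnacle set, and (2) $m > 2|S|$. Moreover, for every integer $m\ge 2$ there are exactly $\binom{m-2}{\lfloor m/2\rfloor}$ admissible pinnacle sets with maximum $m$, and for every integer $n\ge 1$ the number of admissible pinnacle sets $S\subseteq [n]$ (including $S=\emptyset$) is $$1+\sum_{m=3}^{n}\binom{m-2}{\lfloor m/2\rfloor}=\binom{n-1}{\lfloor (n-1)/2\rfloor}.$$
   Context: Let $[n]=\{1,2,\ldots,n\}$ and let $S_n$ be the set of permutations of $[n]$, written as words $w=w(1)w(2)\cdots w(n)$. A pinnacle of $w\in S_n$ is a value $w(i)$ with $2\le i\le n-1$ and $w(i-1)<w(i)>w(i+1)$. The pinnacle set $\mathrm{Pin}(w)$ is the set of all pinnacles of $w$. A set $S$ is an $n$-admissible pinnacle set if there is $w\in S_n$ with $\mathrm{Pin}(w)=S$; it is an admissible pinnacle set if it is $n$-admissible for some $n\ge 1$. In particular $\emptyset$ is admissible. Convention: $\binom{a}{b}=0$ if $b>a\ge 0$; an empty sum is $0$. -}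

module Defs where

open import Data.Fin.Base using (Fin; toℕ)
open import Data.Fin.Permutation using (Permutation′; _⟨$⟩ʳ_)
open import Data.Integer.Base as ℤ using (ℤ; +_)
open import Data.List.Base using (List; length; map; upTo)
open import Data.List.Membership.Propositional using (_∈_)
open import Data.List.Relation.Unary.Linked using (Linked)
open import Data.List.Relation.Unary.Unique.Propositional using (Unique)
open import Data.Nat.Base using (ℕ; suc; _+_; _∸_; _<_; _≤_)
open import Data.Nat.ListAction using (sum)
open import Data.Product.Base using (Σ; ∃-syntax; _×_)
open import Function.Bundles using (_⇔_)
open import Level using (0ℓ)
open import Relation.Binary.PropositionalEquality.Core using (_≡_)
open import Relation.Unary using (Pred; _≐_)

-- Listing the elements in strictly increasing order makes the representation
-- of a finite set unique, so propositional equality of FinSet is equality of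
-- sets and the length of the list is the cardinality.
record FinSet : Set where
  constructor mkFinSet
  field
    elements   : List ℤ
    increasing : Linked ℤ._<_ elements

open FinSet public

⟦_⟧ : FinSet → Pred ℤ 0ℓ
⟦ S ⟧ z = z ∈ elements S

∣_∣ : FinSet → ℕ
∣ S ∣ = length (elements S)

-- In particular S is nonempty.
Max : FinSet → ℤ → Set
Max S m = ⟦ S ⟧ m × (∀ z → ⟦ S ⟧ z → z ℤ.≤ m)

-- Positions and values in Fin n are counted from 0; the shift makes the
-- values of the word range over 1, …, n.
letter : ∀ {n} → Permutation′ n → Fin n → ℕ
letter w i = suc (toℕ (w ⟨$⟩ʳ i))

-- h, i, j are consecutive positions; their existence in Fin n is what
-- excludes the first and the last position for i.
Pin : ∀ {n} → Permutation′ n → Pred ℤ 0ℓ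
Pin {n} w z =
  Σ (Fin n) λ h → Σ (Fin n) λ i → Σ (Fin n) λ j →
    toℕ i ≡ suc (toℕ h) × toℕ j ≡ suc (toℕ i) ×
    letter w h < letter w i × letter w j < letter w i ×
    z ≡ + letter w i

_-Admissible_ : ℕ → Pred ℤ 0ℓ → Set
n -Admissible S = ∃[ w ] Pin {n} w ≐ S

Admissible : Pred ℤ 0ℓ → Set
Admissible S = ∃[ n ] 1 ≤ n × n -Admissible S

[1⋯_] : ℕ → Pred ℤ 0ℓ
[1⋯ n ] z = + 1 ℤ.≤ z × z ℤ.≤ + n

HasExactly : ℕ → Pred FinSet 0ℓ → Set
HasExactly k P =
  Σ (List FinSet) λ Ss → Unique Ss × (∀ S → S ∈ Ss ⇔ P S) × length Ss ≡ k

-- The sum of f m over a ≤ m ≤ b, empty when b < a.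
sumFromTo : ℕ → ℕ → (ℕ → ℕ) → ℕ
sumFromTo a b f = sum (map (λ i → f (a + i)) (upTo (suc b ∸ a)))

{-# OPTIONS --safe #-}
module Submission where

-- An increasing sequence s₁ < s₂ < ⋯ is a pinnacle set iff 2 * i < sᵢ for all i.
-- Necessity: the i pinnacles up to sᵢ, their right neighbours and the left
-- neighbour of the leftmost one are 2 * i + 1 distinct letters. Sufficiency:
-- insert 1, 2, … in turn, keeping the word increasing from position 2 * c on
-- (counted from 0), where c is the number of pinnacles so far; a value goes to
-- the end of the word or, to become a pinnacle, to position 2 * c + 1. Reading a
-- set as a lattice path (down at its elements, up elsewhere), such sets are the
-- paths that stay positive; among those of length k + 1, the paths with at most
-- d ≤ k / 2 downs satisfy the Pascal recurrence, so that there are k C d of them.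

open import Defs
open import Data.Empty using (⊥; ⊥-elim)
open import Data.Fin.Base using (Fin; zero; suc; toℕ; fromℕ; fromℕ<; punchIn; punchOut)
open import Data.Fin.Permutation using (Permutation′; _⟨$⟩ʳ_; _⟨$⟩ˡ_; insert; insert-punchIn; id; inverseˡ)
import Data.Fin.Properties as Fin
open import Data.Integer.Base as ℤ using (ℤ; +_; +≤+; +<+)
import Data.Integer.Properties as ℤ
open import Data.List.Base using (List; []; _∷_; _++_; _∷ʳ_; map; length; lookup; upTo; InitLast; initLast; _∷ʳ′_)
open import Data.List.Extrema.Nat using (min; min≤xs; min≤⊤; argmin-all)
open import Data.List.Membership.Propositional using (_∈_)
open import Data.List.Membership.Propositional.Properties using (∈-++⁻; ∈-++⁺ˡ; ∈-++⁺ʳ; ∈-lookup; ∈-map⁻; ∈-map⁺)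
open import Data.List.Properties using (length-++; length-map; map-++; upTo-∷ʳ; ∷ʳ-injectiveˡ)
open import Data.List.Relation.Binary.Pointwise using (Pointwise; []; _∷_; Pointwise-length)
open import Data.List.Relation.Unary.All as All using (All; []; _∷_)
import Data.List.Relation.Unary.All.Properties as All
open import Data.List.Relation.Unary.AllPairs as AllPairs using (AllPairs; []; _∷_)
import Data.List.Relation.Unary.AllPairs.Properties as AllPairs
open import Data.List.Relation.Unary.Any using (here; there)
import Data.List.Relation.Unary.Linked as Linked
import Data.List.Relation.Unary.Linked.Properties as Linked
open import Data.List.Relation.Unary.Unique.Propositional using (Unique)
import Data.List.Relation.Unary.Unique.Propositional.Properties as Unique
open import Data.Nat.Base using (ℕ; zero; suc; _+_; _*_; _∸_; _≤_; _<_; ⌊_/2⌋; ⌈_/2⌉; z≤n; s≤s; z<s; s≤s⁻¹)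
open import Data.Nat.Combinatorics using (_C_; nCk≡nC[n∸k]; nCn≡1; nCk+nC[k+1]≡[n+1]C[k+1])
open import Data.Nat.ListAction using (sum)
open import Data.Nat.ListAction.Properties using (sum-++)
open import Data.Nat.Properties
open import Data.Product.Base using (∃-syntax; _×_; _,_; proj₁; proj₂)
open import Data.Sum.Base using (_⊎_; inj₁; inj₂)
open import Function.Base using (_∘_)
open import Function.Bundles using (_⇔_; mk⇔; Equivalence)
open import Relation.Binary.PropositionalEquality
open import Relation.Nullary using (¬_; yes; no; contradiction)
open import Relation.Unary using (_≐_; _⊆_; _∖_; ｛_｝)

-- Letters by position, and peaks of a word.

-- Positions are plain naturals counted from 0, so that words of different lengths can be compared
-- position by position.
record At {n} (w : Permutation′ n) (k v : ℕ) : Set where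
  constructor at
  field
    pos   : Fin n
    index : toℕ pos ≡ k
    value : letter w pos ≡ v

-- The index is the position of the left neighbour; the pinnacle itself stands one further to the
-- right.
record PeakAt {n} (w : Permutation′ n) (k : ℕ) (z : ℤ) : Set where
  constructor peakAt
  field
    {left top right} : ℕ
    at-left  : At w k left
    at-top   : At w (suc k) top
    at-right : At w (suc (suc k)) right
    left<top  : left < top
    right<top : right < top
    z≡top     : z ≡ + top

module _ {n} {w : Permutation′ n} where

  at-functional : ∀ {k u v} → At w k u → At w k v → u ≡ v
  at-functional (at i refl refl) (at j eq refl) = cong (letter w) (Fin.toℕ-injective (sym eq))

  at-index< : ∀ {k v} → At w k v → k < n
  at-index< (at i refl _) = Fin.toℕ<n i

  at-value≤ : ∀ {k v} → At w k v → v ≤ n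
  at-value≤ (at i _ refl) = Fin.toℕ<n (w ⟨$⟩ʳ i)

  letterAt : ∀ {k} → k < n → ∃[ v ] At w k v
  letterAt k<n = _ , at (fromℕ< k<n) (Fin.toℕ-fromℕ< k<n) refl

  Pin⇒PeakAt : ∀ {z} → Pin w z → ∃[ k ] PeakAt w k z
  Pin⇒PeakAt (h , i , j , i≡1+h , j≡1+i , l<t , r<t , z≡t) =
    toℕ h , peakAt (at h refl refl) (at i i≡1+h refl)
      (at j (trans j≡1+i (cong suc i≡1+h)) refl) l<t r<t z≡t

  PeakAt⇒Pin : ∀ {k z} → PeakAt w k z → Pin w z
  PeakAt⇒Pin (peakAt (at h refl refl) (at i i≡ refl) (at j j≡ refl) l<t r<t z≡t) =
    h , i , j , i≡ , trans j≡ (cong suc (sym i≡)) , l<t , r<t , z≡t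

AscendingFrom : ℕ → ∀ {n} → Permutation′ n → Set
AscendingFrom p w = ∀ {k u v} → p ≤ k → At w k u → At w (suc k) v → u < v

-- Insertion of a new largest letter.

toℕ-punchIn-< : ∀ {n} (p : Fin (suc n)) (i : Fin n) → toℕ i < toℕ p → toℕ (punchIn p i) ≡ toℕ i
toℕ-punchIn-< (suc p) zero    _         = refl
toℕ-punchIn-< (suc p) (suc i) (s≤s i<p) = cong suc (toℕ-punchIn-< p i i<p)

toℕ-punchIn-≥ : ∀ {n} (p : Fin (suc n)) (i : Fin n) → toℕ p ≤ toℕ i → toℕ (punchIn p i) ≡ suc (toℕ i)
toℕ-punchIn-≥ zero    i       _         = refl
toℕ-punchIn-≥ (suc p) (suc i) (s≤s p≤i) = cong suc (toℕ-punchIn-≥ p i p≤i)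

≡⊎punchIn : ∀ {n} (p i : Fin (suc n)) → i ≡ p ⊎ ∃[ j ] i ≡ punchIn p j
≡⊎punchIn p i with p Fin.≟ i
... | yes p≡i = inj₁ (sym p≡i)
... | no p≢i  = inj₂ (punchOut p≢i , sym (Fin.punchIn-punchOut p≢i))

-- All old letters keep their values: those before `p` keep their positions, those from `p` on move
-- one place to the right.
module InsertMax {n} (w : Permutation′ n) {p} (p<1+n : p < suc n) where

  private
    q : Fin (suc n)
    q = fromℕ< p<1+n

    toℕ-q : toℕ q ≡ p
    toℕ-q = Fin.toℕ-fromℕ< p<1+n

  w⁺ : Permutation′ (suc n)
  w⁺ = insert q (fromℕ n) w

  private
    letter-q : letter w⁺ q ≡ suc n
    letter-q with q Fin.≟ q
    ... | yes _  = cong suc (Fin.toℕ-fromℕ n)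
    ... | no q≢q = contradiction refl q≢q

    letter-punchIn : ∀ i → letter w⁺ (punchIn q i) ≡ letter w i
    letter-punchIn i = cong suc (trans (cong toℕ (insert-punchIn q (fromℕ n) w i))
      (toℕ-punchIn-< (fromℕ n) _ (subst (toℕ (w ⟨$⟩ʳ i) <_) (sym (Fin.toℕ-fromℕ n)) (Fin.toℕ<n (w ⟨$⟩ʳ i)))))

  at-max : At w⁺ p (suc n)
  at-max = at q toℕ-q letter-q

  at-before : ∀ {k v} → k < p → At w k v → At w⁺ k v
  at-before k<p (at i refl refl) =
    at (punchIn q i) (toℕ-punchIn-< q i (subst (toℕ i <_) (sym toℕ-q) k<p)) (letter-punchIn i)

  at-after : ∀ {k v} → p ≤ k → At w k v → At w⁺ (suc k) v
  at-after p≤k (at i refl refl) =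
    at (punchIn q i) (toℕ-punchIn-≥ q i (subst (_≤ toℕ i) (sym toℕ-q) p≤k)) (letter-punchIn i)

  at-max⁻ : ∀ {v} → At w⁺ p v → v ≡ suc n
  at-max⁻ a = at-functional a at-max

  private
    at⁻ : ∀ {k v} → At w⁺ k v →
          (k < p × At w k v) ⊎ k ≡ p ⊎ ∃[ k′ ] (k ≡ suc k′ × p ≤ k′ × At w k′ v)
    at⁻ (at i refl refl) with ≡⊎punchIn q i
    ... | inj₁ refl = inj₂ (inj₁ toℕ-q)
    ... | inj₂ (i′ , refl) with toℕ i′ <? p
    ...   | yes i′<p = inj₁ (subst (_< p) (sym eq) i′<p , at i′ (sym eq) (sym (letter-punchIn i′)))
      where eq = toℕ-punchIn-< q i′ (subst (toℕ i′ <_) (sym toℕ-q) i′<p)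
    ...   | no i′≮p = inj₂ (inj₂ (toℕ i′ , eq , ≮⇒≥ i′≮p , at i′ refl (sym (letter-punchIn i′))))
      where eq = toℕ-punchIn-≥ q i′ (subst (_≤ toℕ i′) (sym toℕ-q) (≮⇒≥ i′≮p))

  at-before⁻ : ∀ {k v} → k < p → At w⁺ k v → At w k v
  at-before⁻ k<p a with at⁻ a
  ... | inj₁ (_ , b)                        = b
  ... | inj₂ (inj₁ refl)                    = contradiction k<p (<-irrefl refl)
  ... | inj₂ (inj₂ (_ , refl , p≤k′ , _))   = contradiction p≤k′ (<⇒≱ (<-trans (n<1+n _) k<p))

  at-after⁻ : ∀ {k v} → p ≤ k → At w⁺ (suc k) v → At w k v
  at-after⁻ p≤k a with at⁻ a
  ... | inj₁ (1+k<p , _)               = contradiction p≤k (<⇒≱ (<-trans (n<1+n _) 1+k<p))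
  ... | inj₂ (inj₁ refl)               = contradiction p≤k 1+n≰n
  ... | inj₂ (inj₂ (_ , refl , _ , b)) = b

  peak-before : ∀ {k z} → suc (suc k) < p → PeakAt w k z → PeakAt w⁺ k z
  peak-before h (peakAt l t r l<t r<t eq) =
    peakAt (at-before (<-trans (<-trans (n<1+n _) (n<1+n _)) h) l) (at-before (<-trans (n<1+n _) h) t)
      (at-before h r) l<t r<t eq

  peak-before⁻ : ∀ {k z} → suc (suc k) < p → PeakAt w⁺ k z → PeakAt w k z
  peak-before⁻ h (peakAt l t r l<t r<t eq) =
    peakAt (at-before⁻ (<-trans (<-trans (n<1+n _) (n<1+n _)) h) l) (at-before⁻ (<-trans (n<1+n _) h) t)
      (at-before⁻ h r) l<t r<t eq

  -- The right neighbour of such a peak would be the largest letter.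
  no-peak-left-of-max : ∀ {k z} → suc (suc k) ≡ p → PeakAt w⁺ k z → ⊥
  no-peak-left-of-max refl (peakAt _ t r _ r<t _) with refl ← at-max⁻ r = <⇒≱ r<t (at-value≤ t)

-- From lattice paths to words.

AscendingFrom⇒peaks-before : ∀ {n p} {w : Permutation′ n} → AscendingFrom p w →
                             ∀ {k z} → PeakAt w k z → suc k < p
AscendingFrom⇒peaks-before asc (peakAt _ t r _ r<t _) = ≰⇒> λ p≤1+k → <-asym r<t (asc p≤1+k t r)

-- A lattice path of height n ∸ 2 * c after n steps; xs lists its c down steps.
data Walk : ℕ → ℕ → List ℤ → Set where
  start : Walk 1 0 []
  up    : ∀ {n c xs} → Walk n c xs → Walk (suc n) c xs
  down  : ∀ {n c xs} → 2 * suc c < suc n → Walk n c xs → Walk (suc n) (suc c) (xs ∷ʳ + suc n)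

walk-height : ∀ {n c xs} → Walk n c xs → 2 * c < n
walk-height start       = z<s
walk-height (up p)      = m<n⇒m<1+n (walk-height p)
walk-height (down lt _) = lt

-- The new largest letter goes to the end, where it has no right neighbour and prolongs the final
-- ascent.
up-word : ∀ {n p} {w : Permutation′ n} → AscendingFrom p w →
          ∃[ w⁺ ] AscendingFrom p {suc n} w⁺ × Pin w⁺ ≐ Pin w
up-word {n} {p} {w} asc = w⁺ , asc⁺ , from , to
  where
  open InsertMax w (n<1+n n)

  asc⁺ : AscendingFrom p w⁺
  asc⁺ {k} p≤k a b with m<1+n⇒m<n∨m≡n (at-index< b)
  ... | inj₂ refl rewrite at-max⁻ b = s≤s (at-value≤ (at-before⁻ (n<1+n k) a))
  ... | inj₁ 1+k<n = asc p≤k (at-before⁻ (<-trans (n<1+n k) 1+k<n) a) (at-before⁻ 1+k<n b)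

  from : ∀ {z} → Pin w⁺ z → Pin w z
  from pin with k , pk ← Pin⇒PeakAt pin | m<1+n⇒m<n∨m≡n (at-index< (PeakAt.at-right pk))
  ... | inj₁ lt = PeakAt⇒Pin (peak-before⁻ lt pk)
  ... | inj₂ eq = ⊥-elim (no-peak-left-of-max eq pk)

  to : ∀ {z} → Pin w z → Pin w⁺ z
  to pin with k , pk ← Pin⇒PeakAt pin = PeakAt⇒Pin (peak-before (at-index< (PeakAt.at-right pk)) pk)

-- The new largest letter goes to position `p + 1`, between two letters of the ascending tail. Old
-- peaks stand before `p`, so they and both their neighbours stay in place.
down-word : ∀ {n p} {w : Permutation′ n} → suc p < n → AscendingFrom p w →
            ∃[ w⁺ ] AscendingFrom (suc (suc p)) {suc n} w⁺ ×
                    Pin w⁺ ≐ λ z → Pin w z ⊎ z ≡ + suc n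
down-word {n} {p} {w} 1+p<n asc = w⁺ , asc⁺ , from , to
  where
  open InsertMax w (m<n⇒m<1+n 1+p<n)

  asc⁺ : AscendingFrom (suc (suc p)) w⁺
  asc⁺ (s≤s p<k) a b =
    asc (<⇒≤ p<k) (at-after⁻ p<k a) (at-after⁻ (m≤n⇒m≤1+n p<k) b)

  from : ∀ {z} → Pin w⁺ z → Pin w z ⊎ z ≡ + suc n
  -- A peak of `w⁺` stands before position `p + 2`. At `p + 1` it is the new letter, at `p` it would
  -- have the new letter on its right, and before `p` it is a peak of `w`.
  from pin with k , pk@(peakAt _ t _ _ _ z≡t) ← Pin⇒PeakAt pin
           with m<1+n⇒m<n∨m≡n (AscendingFrom⇒peaks-before asc⁺ pk)
  ... | inj₂ refl = inj₂ (trans z≡t (cong +_ (at-max⁻ t)))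
  ... | inj₁ (s≤s lt) with m≤n⇒m<n∨m≡n lt
  ...   | inj₁ lt′  = inj₁ (PeakAt⇒Pin (peak-before⁻ (s≤s lt′) pk))
  ...   | inj₂ refl = ⊥-elim (no-peak-left-of-max refl pk)

  to : ∀ {z} → Pin w z ⊎ z ≡ + suc n → Pin w⁺ z
  to (inj₁ pin) with k , pk ← Pin⇒PeakAt pin =
    PeakAt⇒Pin (peak-before (s≤s (AscendingFrom⇒peaks-before asc pk)) pk)
  to (inj₂ refl)
    with _ , l ← letterAt {w = w} (<-trans (n<1+n p) 1+p<n) | _ , r ← letterAt {w = w} 1+p<n =
    PeakAt⇒Pin (peakAt (at-before (n<1+n p) l) at-max (at-after ≤-refl r)
      (s≤s (at-value≤ l)) (s≤s (at-value≤ r)) refl)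

Walk⇒word : ∀ {n c xs} → Walk n c xs → ∃[ w ] AscendingFrom (2 * c) {n} w × Pin w ≐ (_∈ xs)
Walk⇒word start = id , (λ _ _ b → no-second b) ,
  (λ pin → no-second (PeakAt.at-top (proj₂ (Pin⇒PeakAt pin)))) , λ ()
  where
  no-second : ∀ {a} {A : Set a} {k v} → At {1} id (suc k) v → A
  no-second b = contradiction (at-index< b) λ { (s≤s ()) }
Walk⇒word (up p)
  with w , asc , from , to ← Walk⇒word p
  with w⁺ , asc⁺ , from⁺ , to⁺ ← up-word asc
  = w⁺ , asc⁺ , from ∘ from⁺ , to⁺ ∘ to
Walk⇒word {c = suc c} (down {n} {xs = xs} lt p)
  with w , asc , from , to ← Walk⇒word p
  -- The condition of `down` amounts to `2 * c + 1 < n`: positions `2 * c` and `2 * c + 1` exist and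
  -- hold the future neighbours of the new pinnacle.
  with w⁺ , asc⁺ , from⁺ , to⁺ ← down-word (s≤s⁻¹ (subst (_< suc n) (*-suc 2 c) lt)) asc
  = w⁺ , (λ {k} le → asc⁺ (subst (_≤ k) (*-suc 2 c) le)) , from′ , to′
  where
  from′ : ∀ {z} → Pin w⁺ z → z ∈ xs ∷ʳ + suc n
  from′ pin with from⁺ pin
  ... | inj₁ pin′ = ∈-++⁺ˡ (from pin′)
  ... | inj₂ refl = ∈-++⁺ʳ xs (here refl)
  to′ : ∀ {z} → z ∈ xs ∷ʳ + suc n → Pin w⁺ z
  to′ z∈ with ∈-++⁻ xs z∈
  ... | inj₁ z∈xs        = to⁺ (inj₁ (to z∈xs))
  ... | inj₂ (here refl) = to⁺ (inj₂ refl)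

-- Necessity: counting the letters around the pinnacles.

lookup-injective : ∀ {a} {A : Set a} {xs : List A} → Unique xs →
                   ∀ {i j} → lookup xs i ≡ lookup xs j → i ≡ j
lookup-injective (x∉ ∷ _)  {zero}  {zero}  _  = refl
lookup-injective (x∉ ∷ _)  {zero}  {suc j} eq = contradiction eq (All.lookup x∉ (∈-lookup j))
lookup-injective (x∉ ∷ _)  {suc i} {zero}  eq = contradiction (sym eq) (All.lookup x∉ (∈-lookup i))
lookup-injective (_ ∷ xs!) {suc i} {suc j} eq = cong suc (lookup-injective xs! eq)

choose : ∀ {a b r} {A : Set a} {B : Set b} {R : A → B → Set r} {ys} →
         All (λ y → ∃[ x ] R x y) ys → ∃[ xs ] Pointwise R xs ys
choose []              = [] , []
choose ((x , r) ∷ pxs) = let xs , rs = choose pxs in x ∷ xs , r ∷ rs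

Pointwise-unique : ∀ {a b r} {A : Set a} {B : Set b} {R : A → B → Set r} →
                   (∀ {x y z} → R x y → R x z → y ≡ z) →
                   ∀ {xs ys} → Pointwise R xs ys → Unique ys → Unique xs
Pointwise-unique {R = R} functional = unique
  where
  distinct : ∀ {x y xs ys} → R x y → Pointwise R xs ys → All (y ≢_) ys → All (x ≢_) xs
  distinct r []       []          = []
  distinct r (s ∷ rs) (y≢z ∷ y∉) = (λ { refl → y≢z (functional r s) }) ∷ distinct r rs y∉

  unique : ∀ {xs ys} → Pointwise R xs ys → Unique ys → Unique xs
  unique []       []          = []
  unique (r ∷ rs) (y∉ ∷ ys!) = distinct r rs y∉ ∷ unique rs ys!

Pointwise⇒Allˡ : ∀ {a b r p} {A : Set a} {B : Set b} {R : A → B → Set r} {P : B → Set p} {xs ys} →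
                 Pointwise R xs ys → All P ys → All (λ x → ∃[ y ] P y × R x y) xs
Pointwise⇒Allˡ []       []         = []
Pointwise⇒Allˡ (r ∷ rs) (py ∷ pys) = (_ , py , r) ∷ Pointwise⇒Allˡ rs pys

module _ {n} {w : Permutation′ n} where

  at-injective : ∀ {j k v} → At w j v → At w k v → j ≡ k
  at-injective (at i refl refl) (at j refl eq) = cong toℕ (begin
    i                     ≡⟨ inverseˡ w ⟨
    w ⟨$⟩ˡ (w ⟨$⟩ʳ i)     ≡⟨ cong (w ⟨$⟩ˡ_) (Fin.toℕ-injective (suc-injective eq)) ⟨
    w ⟨$⟩ˡ (w ⟨$⟩ʳ j)     ≡⟨ inverseˡ w ⟩
    j                     ∎)
    where open ≡-Reasoning

  -- The letter is written `suc v`, so that `v < m` indexes an element of `Fin m`.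
  Small : ℕ → ℕ → Set
  Small m k = ∃[ v ] v < m × At w k (suc v)

  at⇒Small : ∀ {k v m} → v ≤ m → At w k v → Small m k
  at⇒Small v≤m (at i eq refl) = _ , v≤m , at i eq refl

  -- Pigeonhole: a permutation is injective, so distinct positions give distinct elements of
  -- `Fin m`.
  small-positions : ∀ {m ks} → Unique ks → All (Small m) ks → length ks ≤ m
  small-positions {m} {ks} ks! small = Fin.injective⇒≤ {f = f} f-injective
    where
    s : ∀ i → Small m (lookup ks i)
    s i = All.lookup small (∈-lookup i)

    f : Fin (length ks) → Fin m
    f i = fromℕ< (proj₁ (proj₂ (s i)))

    f-injective : ∀ {i j} → f i ≡ f j → i ≡ j
    f-injective {i} {j} eq with v , v<m , a ← s i | v′ , v′<m , b ← s j
      with refl ← Fin.fromℕ<-injective _ _ v<m v′<m eq = lookup-injective ks! (at-injective a b)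

  peak-functional : ∀ {k y z} → PeakAt w k y → PeakAt w k z → y ≡ z
  peak-functional (peakAt _ t _ _ _ refl) (peakAt _ t′ _ _ _ refl) = cong +_ (at-functional t t′)

  -- Each of the two adjacent letters would have to exceed the other.
  no-adjacent-peaks : ∀ {k y z} → PeakAt w k y → PeakAt w (suc k) z → ⊥
  no-adjacent-peaks (peakAt _ t r _ r<t _) (peakAt l′ t′ _ l′<t′ _ _)
    with refl ← at-functional t l′ | refl ← at-functional r t′ = <-asym r<t l′<t′

  -- The peaks, their right neighbours and the left neighbour of the leftmost peak occupy pairwise
  -- distinct positions, and all hold letters at most `m`.
  pinnacle-bound : ∀ {m x xs} → Unique (x ∷ xs) → All (Pin w) (x ∷ xs) → All (ℤ._≤ + m) (x ∷ xs) →
                   2 * length (x ∷ xs) < m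
  pinnacle-bound {m} {x} {xs} xs! pins xs≤m
    with k ∷ ks , rs ← choose (All.map Pin⇒PeakAt pins)
    = subst (_≤ m) size (small-positions unique small)
    where
    _≤m-PeakAt_ : ℤ → ℕ → Set
    y ≤m-PeakAt j = y ℤ.≤ + m × PeakAt w j y

    peaks : All (λ j → ∃[ y ] y ≤m-PeakAt j) (k ∷ ks)
    peaks = Pointwise⇒Allˡ rs xs≤m

    leftmost : ℕ
    leftmost = min k ks

    positions : List ℕ
    positions = leftmost ∷ map suc (k ∷ ks) ++ map suc (map suc (k ∷ ks))

    small-left : ∀ {j} → (∃[ y ] y ≤m-PeakAt j) → Small m j
    small-left (_ , +≤+ t≤m , peakAt l _ _ l<t _ refl) = at⇒Small (≤-trans (<⇒≤ l<t) t≤m) l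

    small-top : ∀ {j} → (∃[ y ] y ≤m-PeakAt j) → Small m (suc j)
    small-top (_ , +≤+ t≤m , peakAt _ t _ _ _ refl) = at⇒Small t≤m t

    small-right : ∀ {j} → (∃[ y ] y ≤m-PeakAt j) → Small m (suc (suc j))
    small-right (_ , +≤+ t≤m , peakAt _ _ r _ r<t refl) = at⇒Small (≤-trans (<⇒≤ r<t) t≤m) r

    small : All (Small m) positions
    -- The minimum is itself one of `k ∷ ks`, so position `leftmost` holds the left neighbour of a
    -- peak.
    small = argmin-all (λ j → j) (small-left (All.head peaks)) (All.map small-left (All.tail peaks))
      ∷ All.++⁺ (All.map⁺ (All.map small-top peaks)) (All.map⁺ (All.map⁺ (All.map small-right peaks)))

    leftmost≤ : All (leftmost ≤_) (k ∷ ks)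
    leftmost≤ = min≤⊤ k ks ∷ min≤xs k ks

    unique-ks : Unique (k ∷ ks)
    unique-ks = Pointwise-unique peak-functional rs xs!

    unique : Unique positions
    unique = All.++⁺ (All.map⁺ (All.map (λ le → <⇒≢ (s≤s le)) leftmost≤))
                     (All.map⁺ (All.map⁺ (All.map (λ le → <⇒≢ (s≤s (m≤n⇒m≤1+n le))) leftmost≤)))
      ∷ Unique.++⁺ (Unique.map⁺ suc-injective unique-ks)
                   (Unique.map⁺ suc-injective (Unique.map⁺ suc-injective unique-ks))
                   λ { (p , q) → disjoint p q }
      where
      disjoint : ∀ {v} → v ∈ map suc (k ∷ ks) → v ∈ map suc (map suc (k ∷ ks)) → ⊥
      disjoint p q
        -- A position that is both a peak and the right neighbour of a peak would give two adjacent
        -- peaks.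
        with i , i∈ , refl ← ∈-map⁻ suc p | _ , q′ , refl ← ∈-map⁻ suc q
        with j , j∈ , refl ← ∈-map⁻ suc q′
        with _ , _ , pi ← All.lookup peaks i∈ | _ , _ , pj ← All.lookup peaks j∈
        = no-adjacent-peaks pj pi

    size : length positions ≡ suc (2 * length (x ∷ xs))
    size = cong suc (begin
      length (map suc (k ∷ ks) ++ map suc (map suc (k ∷ ks))) ≡⟨ length-++ (map suc (k ∷ ks)) ⟩
      length (map suc (k ∷ ks)) + length (map suc (map suc (k ∷ ks)))
        ≡⟨ cong₂ _+_ (length-map suc (k ∷ ks)) (trans (length-map suc (map suc (k ∷ ks))) (length-map suc (k ∷ ks))) ⟩
      length (k ∷ ks) + length (k ∷ ks)                     ≡⟨ cong (λ l → l + l) (Pointwise-length rs) ⟩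
      length (x ∷ xs) + length (x ∷ xs)                     ≡⟨ cong (λ l → length (x ∷ xs) + l) (+-identityʳ _) ⟨
      2 * length (x ∷ xs)                                   ∎)
      where
      open ≡-Reasoning

-- From pinnacles to lattice paths and back.

Increasing : List ℤ → Set
Increasing = AllPairs ℤ._<_

increasing⇒unique : ∀ {xs} → Increasing xs → Unique xs
increasing⇒unique = AllPairs.map ℤ.<⇒≢

increasing-∷ʳ⁻ : ∀ xs {z} → Increasing (xs ∷ʳ z) → Increasing xs × All (ℤ._< z) xs
increasing-∷ʳ⁻ []       _           = [] , []
increasing-∷ʳ⁻ (x ∷ xs) (x< ∷ xs↑) =
  let x<xs , x<z = All.∷ʳ⁻ x< ; xs↑′ , xs<z = increasing-∷ʳ⁻ xs xs↑ in x<xs ∷ xs↑′ , x<z ∷ xs<z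

increasing-∷ʳ⁺ : ∀ {xs z} → Increasing xs → All (ℤ._< z) xs → Increasing (xs ∷ʳ z)
increasing-∷ʳ⁺ xs↑ xs<z = AllPairs.++⁺ xs↑ ([] ∷ []) (All.map (_∷ []) xs<z)

length-∷ʳ : ∀ {a} {A : Set a} (xs : List A) {x} → length (xs ∷ʳ x) ≡ suc (length xs)
length-∷ʳ xs = trans (length-++ xs) (+-comm _ 1)

<1+⇒≤ : ∀ {z n} → z ℤ.< + suc n → z ℤ.≤ + n
<1+⇒≤ ℤ.-<+            = ℤ.-≤+
<1+⇒≤ (+<+ (s≤s le)) = +≤+ le

≤⇒<1+ : ∀ {z n} → z ℤ.≤ + n → z ℤ.< + suc n
≤⇒<1+ le = ℤ.≤-<-trans le (+<+ (n<1+n _))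

-- The form used when the largest element is split off at the end of the list.
pinnacle-bound-∷ʳ : ∀ {n} {w : Permutation′ n} {m} xs {z} →
                    Unique (xs ∷ʳ z) → All (Pin w) (xs ∷ʳ z) → All (ℤ._≤ + m) (xs ∷ʳ z) →
                    2 * suc (length xs) < m
pinnacle-bound-∷ʳ {w = w} {m} xs u p l = subst (λ k → 2 * k < m) (length-∷ʳ xs) (bound xs u p l)
  where
  bound : ∀ xs {z} → Unique (xs ∷ʳ z) → All (Pin w) (xs ∷ʳ z) → All (ℤ._≤ + m) (xs ∷ʳ z) →
          2 * length (xs ∷ʳ z) < m
  bound []      = pinnacle-bound {w = w}
  bound (_ ∷ _) = pinnacle-bound {w = w}

-- The values are read downwards from `n`, which is any positive bound and not the length of `w`.
-- Since `xs` need only consist of pinnacles, the hypothesis survives the removal of the maximum.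
pinnacles⇒Walk : ∀ {N} {w : Permutation′ N} {n xs} → 1 ≤ n → Increasing xs → All (Pin w) xs →
                 All (ℤ._≤ + n) xs → Walk n (length xs) xs
pinnacles⇒Walk {w = w} {suc n} {xs} _ xs↑ pins xs≤ = walk n (initLast xs) xs↑ pins xs≤
  where
  walk : ∀ n {xs} → InitLast xs → Increasing xs → All (Pin w) xs →
         All (ℤ._≤ + suc n) xs → Walk (suc n) (length xs) xs
  walk zero    [] _ _ _ = start
  walk (suc n) [] _ _ _ = up (walk n [] [] [] [])
  walk zero (ys ∷ʳ′ z) xs↑ pins xs≤
    -- A pinnacle that is at most 1 contradicts the bound, which would read
    -- `2 * suc (length ys) < 1`.
    with s≤s () ← pinnacle-bound-∷ʳ {w = w} ys (increasing⇒unique xs↑) pins xs≤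
  walk (suc n) (ys ∷ʳ′ z) xs↑ pins xs≤
    with ys↑ , ys<z ← increasing-∷ʳ⁻ ys xs↑ | ys≤ , z≤ ← All.∷ʳ⁻ xs≤ | z ℤ.≟ + suc (suc n)
  ... | yes refl = subst (λ c → Walk (suc (suc n)) c (ys ∷ʳ z)) (sym (length-∷ʳ ys))
    (down (pinnacle-bound-∷ʳ {w = w} ys (increasing⇒unique xs↑) pins xs≤)
      (walk n (initLast ys) ys↑ (proj₁ (All.∷ʳ⁻ pins)) (All.map <1+⇒≤ ys<z)))
  -- The largest element differs from the current value, so all elements lie below it and the step
  -- goes up.
  ... | no z≢ = up (walk n (ys ∷ʳ′ z) xs↑ pins
    (All.∷ʳ⁺ (All.map (λ y<z → <1+⇒≤ (ℤ.<-≤-trans y<z z≤)) ys<z) (<1+⇒≤ (ℤ.≤∧≢⇒< z≤ z≢))))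

Walk⇒bounded : ∀ {n c xs} → Walk n c xs → All (ℤ._≤ + n) xs
Walk⇒bounded start      = []
Walk⇒bounded (up p)     = All.map (λ x≤n → ℤ.≤-trans x≤n (+≤+ (n≤1+n _))) (Walk⇒bounded p)
Walk⇒bounded (down _ p) =
  All.∷ʳ⁺ (All.map (λ x≤n → ℤ.≤-trans x≤n (+≤+ (n≤1+n _))) (Walk⇒bounded p)) ℤ.≤-refl

Walk⇒positive : ∀ {n c xs} → Walk n c xs → All (+ 1 ℤ.≤_) xs
Walk⇒positive start      = []
Walk⇒positive (up p)     = Walk⇒positive p
Walk⇒positive (down _ p) = All.∷ʳ⁺ (Walk⇒positive p) (+≤+ z<s)

Walk⇒increasing : ∀ {n c xs} → Walk n c xs → Increasing xs
Walk⇒increasing start      = []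
Walk⇒increasing (up p)     = Walk⇒increasing p
Walk⇒increasing (down _ p) = increasing-∷ʳ⁺ (Walk⇒increasing p) (All.map ≤⇒<1+ (Walk⇒bounded p))

Walk⇒Admissible : ∀ {n c xs} → Walk n c xs → Admissible (_∈ xs)
Walk⇒Admissible {n} p with w , _ , pin ← Walk⇒word p = n , ≤-trans z<s (walk-height p) , w , pin

-- Enumeration of lattice paths with a bounded number of down steps.

C-sym : ∀ i j → (i + j) C i ≡ (i + j) C j
C-sym i j = trans (nCk≡nC[n∸k] (m≤m+n i j)) (cong ((i + j) C_) (m+n∸m≡n i j))

2*-cancel-< : ∀ {c d} → 2 * c < 2 + d * 2 → c ≤ d
2*-cancel-< {c} {d} lt = s≤s⁻¹ (*-cancelˡ-< 2 c (suc d) (subst (2 * c <_) (*-comm (suc d) 2) lt))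

2*-mono-≤ : ∀ {c d} → c ≤ d → 2 * c ≤ d * 2
2*-mono-≤ {c} {d} c≤d = subst (2 * c ≤_) (*-comm 2 d) (*-monoʳ-≤ 2 c≤d)

-- With the factor 2 on the right, `suc d * 2` computes to two successors of `d * 2`; `h` is the
-- parity of `k`.
halve : ∀ k → ∃[ h ] h ≤ 1 × k ≡ ⌊ k /2⌋ * 2 + h
halve 0             = 0 , z≤n , refl
halve 1             = 1 , s≤s z≤n , refl
halve (suc (suc k)) = let h , h≤1 , eq = halve k in h , h≤1 , cong (λ l → suc (suc l)) eq

-- For k = d * 2 + h: the pinnacle sets in [1⋯ suc k] with at most d elements.
enum : ℕ → ℕ → ℕ → List (List ℤ)
enum _       zero    _       = [] ∷ []
enum zero    (suc d) _       = []
enum (suc k) (suc d) zero    = enum k d 1 ++ map (_∷ʳ + suc (suc k)) (enum k d 1)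
enum (suc k) (suc d) (suc h) = enum k (suc d) h ++ map (_∷ʳ + suc (suc k)) (enum k d (suc (suc h)))

-- The invariant `k ≡ d * 2 + h` for the recursive calls of `enum`: `cancel-step` serves the up
-- branch when `h` is positive, `trade-step` all other branches.
cancel-step : ∀ {k d h} → suc k ≡ suc d * 2 + suc h → k ≡ suc d * 2 + h
cancel-step {d = d} {h} eq = suc-injective (trans eq (+-suc (suc d * 2) h))

trade-step : ∀ {k d h} → suc k ≡ suc d * 2 + h → k ≡ d * 2 + suc h
trade-step {d = d} {h} eq = trans (suc-injective eq) (sym (+-suc (d * 2) h))

Walk-empty : ∀ {n} → Walk (suc n) 0 []
Walk-empty {zero}  = start
Walk-empty {suc n} = up Walk-empty

Walk-0-empty : ∀ {n xs} → Walk n 0 xs → xs ≡ []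
Walk-0-empty start  = refl
Walk-0-empty (up p) = Walk-0-empty p

private
  -- A walk with at most `d` downs may always go down next, because `2 * (d + 1) ≤ k + 1`.
  sound-down : ∀ {k d h xs} → suc k ≡ suc d * 2 + h →
               (∀ {ys} → ys ∈ xs → ∃[ c ] c ≤ d × Walk (suc k) c ys) →
               ∀ {zs} → zs ∈ map (_∷ʳ + suc (suc k)) xs → ∃[ c ] c ≤ suc d × Walk (suc (suc k)) c zs
  sound-down {k} {d} {h} eq ih zs∈ with ys , ys∈ , refl ← ∈-map⁻ (_∷ʳ _) zs∈ with c , c≤d , p ← ih ys∈ =
    suc c , s≤s c≤d ,
    down (s≤s (≤-trans (2*-mono-≤ (s≤s c≤d)) (subst (suc d * 2 ≤_) (sym eq) (m≤m+n _ h)))) p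

  widen : ∀ {n d e xs} → d ≤ e → (∃[ c ] c ≤ d × Walk n c xs) → ∃[ c ] c ≤ e × Walk (suc n) c xs
  widen d≤e (c , c≤d , p) = c , ≤-trans c≤d d≤e , up p

enum-sound : ∀ k d h → k ≡ d * 2 + h → ∀ {xs} → xs ∈ enum k d h → ∃[ c ] c ≤ d × Walk (suc k) c xs
enum-sound k zero h eq (here refl) = 0 , z≤n , Walk-empty
enum-sound (suc k) (suc d) zero eq xs∈ with ∈-++⁻ (enum k d 1) xs∈
... | inj₁ l = widen (n≤1+n d) (enum-sound k d 1 (trade-step {d = d} eq) l)
... | inj₂ r = sound-down {d = d} eq (enum-sound k d 1 (trade-step {d = d} eq)) r
enum-sound (suc k) (suc d) (suc h) eq xs∈ with ∈-++⁻ (enum k (suc d) h) xs∈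
... | inj₁ l = widen ≤-refl (enum-sound k (suc d) h (cancel-step {d = d} eq) l)
... | inj₂ r = sound-down {d = d} eq (enum-sound k d (suc (suc h)) (trade-step {d = d} eq)) r

enum-complete : ∀ k d h → k ≡ d * 2 + h → ∀ {c xs} → c ≤ d → Walk (suc k) c xs → xs ∈ enum k d h
enum-complete k zero h eq z≤n p rewrite Walk-0-empty p = here refl
-- Here `k + 1 = 2 * (d + 1)`, so positive height before the last step already forces `c ≤ d`; hence
-- the up branch of `enum` also uses `d`.
enum-complete (suc k) (suc d) zero eq c≤ (up p) =
  ∈-++⁺ˡ (enum-complete k d 1 k≡ (2*-cancel-< (≤-trans (walk-height p) (≤-reflexive 1+k≡))) p)
  where
  k≡ = trade-step {d = d} eq
  1+k≡ = cong suc (trans k≡ (+-comm (d * 2) 1))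
enum-complete (suc k) (suc d) zero eq (s≤s c≤d) (down _ p) =
  ∈-++⁺ʳ (enum k d 1) (∈-map⁺ (_∷ʳ _) (enum-complete k d 1 (trade-step {d = d} eq) c≤d p))
enum-complete (suc k) (suc d) (suc h) eq c≤ (up p) =
  ∈-++⁺ˡ (enum-complete k (suc d) h (cancel-step {d = d} eq) c≤ p)
enum-complete (suc k) (suc d) (suc h) eq (s≤s c≤d) (down _ p) =
  ∈-++⁺ʳ (enum k (suc d) h) (∈-map⁺ (_∷ʳ _) (enum-complete k d (suc (suc h)) (trade-step {d = d} eq) c≤d p))

map-∷ʳ-unique : ∀ {z : ℤ} {xss} → Unique xss → Unique (map (_∷ʳ z) xss)
map-∷ʳ-unique = Unique.map⁺ (λ {xs} {ys} → ∷ʳ-injectiveˡ xs ys)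

-- The two branches are disjoint: lists of the second end in `k + 2`, those of the first are bounded
-- by `k + 1`.
enum-unique : ∀ k d h → k ≡ d * 2 + h → Unique (enum k d h)
enum-unique k zero h eq = [] ∷ []
enum-unique (suc k) (suc d) h eq = go h eq
  where
  disjoint : ∀ {xss yss} → (∀ {xs} → xs ∈ xss → ∃[ c ] c ≤ suc d × Walk (suc k) c xs) →
             ∀ {v} → ¬ (v ∈ xss × v ∈ map (_∷ʳ + suc (suc k)) yss)
  disjoint sound (v∈ , v∈′) with ys , _ , refl ← ∈-map⁻ (_∷ʳ _) v∈′ with _ , _ , p ← sound v∈
    with +≤+ le ← proj₂ (All.∷ʳ⁻ (Walk⇒bounded p)) = 1+n≰n le

  go : ∀ h → suc k ≡ suc d * 2 + h → Unique (enum (suc k) (suc d) h)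
  go zero eq = Unique.++⁺ (enum-unique k d 1 eq′) (map-∷ʳ-unique (enum-unique k d 1 eq′))
    (disjoint λ xs∈ → let c , c≤d , p = enum-sound k d 1 eq′ xs∈ in c , m≤n⇒m≤1+n c≤d , p)
    where eq′ = trade-step {d = d} eq
  go (suc h) eq = Unique.++⁺ (enum-unique k (suc d) h (cancel-step {d = d} eq))
    (map-∷ʳ-unique (enum-unique k d (suc (suc h)) (trade-step {d = d} eq)))
    (disjoint (enum-sound k (suc d) h (cancel-step {d = d} eq)))

-- The two branches are the two summands of Pascal's rule. For `h = 0` both have size `k C d`, and
-- the central symmetry of row `k = 2 * d + 1` supplies the other summand.
length-enum : ∀ k d h → k ≡ d * 2 + h → length (enum k d h) ≡ k C d
length-enum k zero h eq = sym (trans (C-sym 0 k) (nCn≡1 k))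
length-enum (suc k) (suc d) zero eq = begin
  length (enum k d 1 ++ map (_∷ʳ _) (enum k d 1))          ≡⟨ length-++ (enum k d 1) ⟩
  length (enum k d 1) + length (map (_∷ʳ _) (enum k d 1))  ≡⟨ cong₂ _+_ ih (trans (length-map _ (enum k d 1)) ih) ⟩
  k C d + k C d                                             ≡⟨ cong (λ l → k C d + l) middle ⟩
  k C d + k C suc d                                         ≡⟨ nCk+nC[k+1]≡[n+1]C[k+1] k d ⟩
  suc k C suc d                                             ∎
  where
  open ≡-Reasoning
  ih = length-enum k d 1 (trade-step {d = d} eq)
  k≡ : k ≡ d + suc d
  k≡ = begin
    k           ≡⟨ trade-step {d = d} eq ⟩
    d * 2 + 1   ≡⟨ +-comm (d * 2) 1 ⟩
    suc (d * 2) ≡⟨ cong suc (*-comm d 2) ⟩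
    suc (d + (d + 0)) ≡⟨ cong (λ l → suc (d + l)) (+-identityʳ d) ⟩
    suc (d + d) ≡⟨ +-suc d d ⟨
    d + suc d   ∎
  middle : k C d ≡ k C suc d
  middle = subst (λ k → k C d ≡ k C suc d) (sym k≡) (C-sym d (suc d))
length-enum (suc k) (suc d) (suc h) eq = begin
  length (enum k (suc d) h ++ map (_∷ʳ _) (enum k d (suc (suc h))))
    ≡⟨ length-++ (enum k (suc d) h) ⟩
  length (enum k (suc d) h) + length (map (_∷ʳ _) (enum k d (suc (suc h))))
    ≡⟨ cong₂ _+_ (length-enum k (suc d) h (cancel-step {d = d} eq))
        (trans (length-map _ (enum k d (suc (suc h)))) (length-enum k d (suc (suc h)) (trade-step {d = d} eq))) ⟩
  k C suc d + k C d ≡⟨ +-comm (k C suc d) (k C d) ⟩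
  k C d + k C suc d ≡⟨ nCk+nC[k+1]≡[n+1]C[k+1] k d ⟩
  suc k C suc d     ∎
  where open ≡-Reasoning

-- Counting finite sets through their lists of elements.

elements-increasing : ∀ S → Increasing (elements S)
elements-increasing S = Linked.Linked⇒AllPairs ℤ.<-trans (increasing S)

-- Proofs that a list is increasing are unique.
elements-injective : ∀ {S T} → elements S ≡ elements T → S ≡ T
elements-injective {mkFinSet xs p} {mkFinSet .xs q} refl = cong (mkFinSet xs) (Linked.irrelevant ℤ.<-irrelevant p q)

finSets : ∀ {xss} → All Increasing xss → List FinSet
finSets = All.reduce (mkFinSet _ ∘ Linked.AllPairs⇒Linked)

map-elements-finSets : ∀ {xss} (xss↑ : All Increasing xss) → map elements (finSets xss↑) ≡ xss
map-elements-finSets []          = refl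
map-elements-finSets (_ ∷ xss↑) = cong (_ ∷_) (map-elements-finSets xss↑)

-- Counting is done on bare lists; the proofs of increase are attached afterwards, and
-- `elements-injective` makes this harmless.
hasExactly : ∀ {P k xss} → length xss ≡ k → Unique xss → (∀ {xs} → xs ∈ xss → Increasing xs) →
             (∀ S → elements S ∈ xss ⇔ P S) → HasExactly k P
hasExactly {P} {xss = xss} size xss! xss↑ correct =
  Ss , Unique.map⁻ (subst Unique (sym elements-Ss) xss!) , member ,
  trans (sym (length-map elements Ss)) (trans (cong length elements-Ss) size)
  where
  Ss : List FinSet
  Ss = finSets (All.tabulate xss↑)

  elements-Ss : map elements Ss ≡ xss
  elements-Ss = map-elements-finSets (All.tabulate xss↑)

  member : ∀ S → S ∈ Ss ⇔ P S
  member S = mk⇔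
    (λ S∈ → Equivalence.to (correct S) (subst (elements S ∈_) elements-Ss (∈-map⁺ elements S∈)))
    λ PS → back (subst (elements S ∈_) (sym elements-Ss) (Equivalence.from (correct S) PS))
    where
    back : elements S ∈ map elements Ss → S ∈ Ss
    back e∈ with T , T∈ , eq ← ∈-map⁻ elements e∈ = subst (_∈ Ss) (sym (elements-injective eq)) T∈

-- The criterion for adjoining a maximum.

max-last : ∀ {xs m} → Increasing xs → m ∈ xs → (∀ z → z ∈ xs → z ℤ.≤ m) →
           ∃[ ys ] Increasing ys × All (ℤ._< m) ys × xs ≡ ys ∷ʳ m
max-last {xs} xs↑ m∈ ≤m with initLast xs
... | ys ∷ʳ′ z with ys↑ , ys<z ← increasing-∷ʳ⁻ ys xs↑ | ∈-++⁻ ys m∈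
...   | inj₁ m∈ys        = contradiction (≤m z (∈-++⁺ʳ ys (here refl))) (ℤ.<⇒≱ (All.lookup ys<z m∈ys))
...   | inj₂ (here refl) = ys , ys↑ , ys<z , refl

Admissible-resp-≐ : ∀ {P Q} → P ≐ Q → Admissible P → Admissible Q
Admissible-resp-≐ (P⊆Q , Q⊆P) (n , 1≤n , w , from , to) = n , 1≤n , w , P⊆Q ∘ from , to ∘ Q⊆P

-- The endpoint `n` may be any positive bound of the set, whatever the length of the witnessing
-- word.
Admissible⇒Walk : ∀ {n xs} → 1 ≤ n → Increasing xs → Admissible (_∈ xs) → All (ℤ._≤ + n) xs →
                  Walk n (length xs) xs
Admissible⇒Walk 1≤n xs↑ (_ , _ , w , _ , to) = pinnacles⇒Walk {w = w} 1≤n xs↑ (All.tabulate to)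

∷ʳ-∖ : ∀ {ys m} → All (ℤ._< m) ys → (_∈ ys ∷ʳ m) ∖ ｛ m ｝ ≐ (_∈ ys)
∷ʳ-∖ {ys} {m} ys<m = from , λ z∈ → ∈-++⁺ˡ z∈ , λ { refl → ℤ.<-irrefl refl (All.lookup ys<m z∈) }
  where
  from : ∀ {z} → z ∈ ys ∷ʳ m × ¬ (m ≡ z) → z ∈ ys
  from (z∈ , m≢z) with ∈-++⁻ ys z∈
  ... | inj₁ z∈ys        = z∈ys
  ... | inj₂ (here refl) = contradiction refl m≢z

-- The elements of `ys` are pinnacles of the same word, so they trace a walk, which yields a word
-- with exactly these pinnacles.
Admissible-∷ʳ⁻ : ∀ {ys m} → Increasing ys → All (ℤ._< m) ys → Admissible (_∈ ys ∷ʳ m) →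
                 Admissible (_∈ ys) × + (2 * suc (length ys)) ℤ.< m
Admissible-∷ʳ⁻ {ys} ys↑ ys<m (_ , _ , w , _ , to)
  with pins ← All.tabulate {P = Pin w} to
  -- As a pinnacle, `m` is a letter; the match turns the integer into a positive natural number.
  with _ , peakAt _ (at i _ refl) _ _ _ refl ← Pin⇒PeakAt {w = w} (proj₂ (All.∷ʳ⁻ {xs = ys} pins)) =
    Walk⇒Admissible (pinnacles⇒Walk {w = w} z<s ys↑ (proj₁ (All.∷ʳ⁻ pins)) ys≤m) ,
    +<+ (pinnacle-bound-∷ʳ {w = w} ys (increasing⇒unique (increasing-∷ʳ⁺ ys↑ ys<m)) pins (All.∷ʳ⁺ ys≤m ℤ.≤-refl))
  where
  ys≤m = All.map ℤ.<⇒≤ ys<m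

-- The inequality is exactly the condition for a down step at `m`, after a walk for `ys` that ends
-- at `m - 1`.
Admissible-∷ʳ⁺ : ∀ {ys m} → Increasing ys → All (ℤ._< m) ys → Admissible (_∈ ys) →
                 + (2 * suc (length ys)) ℤ.< m → Admissible (_∈ ys ∷ʳ m)
Admissible-∷ʳ⁺ {m = + suc n} ys↑ ys<m adm (+<+ lt) =
  Walk⇒Admissible (down lt (Admissible⇒Walk (≤-trans z<s (s≤s⁻¹ lt)) ys↑ adm (All.map <1+⇒≤ ys<m)))

maximum-criterion : ∀ (S : FinSet) (m : ℤ) → Max S m →
  Admissible ⟦ S ⟧ ⇔ (Admissible (⟦ S ⟧ ∖ ｛ m ｝) × + (2 * ∣ S ∣) ℤ.< m)
maximum-criterion S m (m∈ , ≤m) with elements S | max-last (elements-increasing S) m∈ ≤m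
... | _ | ys , ys↑ , ys<m , refl rewrite length-∷ʳ ys {m} = mk⇔
  (λ adm → let adm′ , lt = Admissible-∷ʳ⁻ ys↑ ys<m adm in
    Admissible-resp-≐ (proj₂ (∷ʳ-∖ ys<m) , proj₁ (∷ʳ-∖ ys<m)) adm′ , lt)
  λ { (adm , lt) → Admissible-∷ʳ⁺ ys↑ ys<m (Admissible-resp-≐ (∷ʳ-∖ ys<m) adm) lt }

-- The two counts.

-- For `m = j + 3`, removing the maximum leaves a walk to `j + 2` whose number of downs `c`
-- satisfies `2 * (c + 1) < j + 3`, that is, `c ≤ ⌊ j /2⌋`.
count-with-maximum : ∀ m → 2 ≤ m →
  HasExactly ((m ∸ 2) C ⌊ m /2⌋) (λ S → Admissible ⟦ S ⟧ × Max S (+ m))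
count-with-maximum 1 (s≤s ())
count-with-maximum 2 _ = hasExactly refl [] (λ ()) correct
  where
  correct : ∀ S → elements S ∈ [] ⇔ (Admissible ⟦ S ⟧ × Max S (+ 2))
  correct S = mk⇔ (λ ()) absurd
    where
    absurd : Admissible ⟦ S ⟧ × Max S (+ 2) → elements S ∈ []
    absurd (adm , m∈ , ≤m)
      with elements S | max-last (elements-increasing S) m∈ ≤m
    -- The criterion would require `2 * suc (length ys) < 2`.
    ... | _ | ys , ys↑ , ys<m , refl with +<+ lt ← proj₂ (Admissible-∷ʳ⁻ ys↑ ys<m adm) =
      contradiction lt (≤⇒≯ (*-monoʳ-≤ 2 (s≤s z≤n)))
count-with-maximum (suc (suc (suc j))) _ with h , h≤1 , j≡ ← halve j =
  hasExactly size (map-∷ʳ-unique (enum-unique (suc j) d (suc h) 1+j≡)) increasing′ correct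
  where
  d = ⌊ j /2⌋
  top = + suc (suc (suc j))
  xss = enum (suc j) d (suc h)

  1+j≡ : suc j ≡ d * 2 + suc h
  1+j≡ = trans (cong suc j≡) (sym (+-suc (d * 2) h))

  size : length (map (_∷ʳ top) xss) ≡ suc j C suc ⌈ j /2⌉
  size = begin
    length (map (_∷ʳ top) xss) ≡⟨ length-map _ xss ⟩
    length xss                 ≡⟨ length-enum (suc j) d (suc h) 1+j≡ ⟩
    -- Symmetry in row `j + 1`; the lower index `suc ⌈ j /2⌉` is what `⌊ j + 3 /2⌋` computes to.
    suc j C d                  ≡⟨ subst (λ n → n C d ≡ n C suc ⌈ j /2⌉)
                                   (trans (+-suc d ⌈ j /2⌉) (cong suc (⌊n/2⌋+⌈n/2⌉≡n j)))
                                   (C-sym d (suc ⌈ j /2⌉)) ⟩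
    suc j C suc ⌈ j /2⌉        ∎
    where open ≡-Reasoning

  walk : ∀ {xs} → xs ∈ map (_∷ʳ top) xss → ∃[ c ] Walk (suc (suc (suc j))) c xs
  walk xs∈ with ys , ys∈ , refl ← ∈-map⁻ (_∷ʳ top) xs∈
    with c , c≤d , p ← enum-sound (suc j) d (suc h) 1+j≡ ys∈ =
    suc c , down (s≤s (≤-trans (2*-mono-≤ (s≤s c≤d)) (s≤s (s≤s (subst (d * 2 ≤_) (sym j≡) (m≤m+n _ h)))))) p

  increasing′ : ∀ {xs} → xs ∈ map (_∷ʳ top) xss → Increasing xs
  increasing′ xs∈ = Walk⇒increasing (proj₂ (walk xs∈))

  correct : ∀ S → elements S ∈ map (_∷ʳ top) xss ⇔ (Admissible ⟦ S ⟧ × Max S top)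
  correct S = mk⇔ to from
    where
    to : elements S ∈ map (_∷ʳ top) xss → Admissible ⟦ S ⟧ × Max S top
    to S∈ with _ , p ← walk S∈ = Walk⇒Admissible p , top∈ , λ _ → All.lookup (Walk⇒bounded p)
      where
      top∈ : top ∈ elements S
      top∈ with ys , _ , eq ← ∈-map⁻ (_∷ʳ top) S∈ = subst (top ∈_) (sym eq) (∈-++⁺ʳ ys (here refl))

    from : Admissible ⟦ S ⟧ × Max S top → elements S ∈ map (_∷ʳ top) xss
    from (adm , m∈ , ≤m) with elements S | max-last (elements-increasing S) m∈ ≤m
    ... | _ | ys , ys↑ , ys<m , refl with adm′ , +<+ lt ← Admissible-∷ʳ⁻ ys↑ ys<m adm =
      ∈-map⁺ (_∷ʳ top) (enum-complete (suc j) d (suc h) 1+j≡ small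
        (Admissible⇒Walk z<s ys↑ adm′ (All.map <1+⇒≤ ys<m)))
      where
      open ≤-Reasoning
      small : length ys ≤ d
      small = s≤s⁻¹ (2*-cancel-< (begin-strict
        2 * suc (length ys)   <⟨ lt ⟩
        3 + j                 ≡⟨ cong (λ l → 3 + l) j≡ ⟩
        3 + (d * 2 + h)       ≤⟨ +-monoʳ-≤ 3 (+-monoʳ-≤ (d * 2) h≤1) ⟩
        3 + (d * 2 + 1)       ≡⟨ cong (λ l → 3 + l) (+-comm (d * 2) 1) ⟩
        2 + suc d * 2         ∎))

-- Every walk to `k + 1` has at most `⌊ k /2⌋` downs because its height is positive, so `enum` with
-- this bound lists all of them.
count-in-interval : ∀ k → HasExactly (k C ⌊ k /2⌋) (λ S → Admissible ⟦ S ⟧ × ⟦ S ⟧ ⊆ [1⋯ suc k ])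
count-in-interval k with h , h≤1 , k≡ ← halve k =
  hasExactly (length-enum k d h k≡) (enum-unique k d h k≡)
    (λ xs∈ → let _ , _ , p = enum-sound k d h k≡ xs∈ in Walk⇒increasing p)
    λ S → mk⇔ (to S) (from S)
  where
  d = ⌊ k /2⌋

  to : ∀ S → elements S ∈ enum k d h → Admissible ⟦ S ⟧ × ⟦ S ⟧ ⊆ [1⋯ suc k ]
  to S S∈ with _ , _ , p ← enum-sound k d h k≡ S∈ =
    Walk⇒Admissible p , λ z∈ → All.lookup (Walk⇒positive p) z∈ , All.lookup (Walk⇒bounded p) z∈

  from : ∀ S → Admissible ⟦ S ⟧ × ⟦ S ⟧ ⊆ [1⋯ suc k ] → elements S ∈ enum k d h
  from S (adm , S⊆) = enum-complete k d h k≡ (2*-cancel-< small) p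
    where
    p = Admissible⇒Walk z<s (elements-increasing S) adm (All.tabulate (proj₂ ∘ S⊆))
    open ≤-Reasoning
    small : 2 * ∣ S ∣ < 2 + d * 2
    small = begin-strict
      2 * ∣ S ∣         <⟨ walk-height p ⟩
      suc k             ≡⟨ cong suc k≡ ⟩
      suc (d * 2 + h)   ≤⟨ s≤s (+-monoʳ-≤ (d * 2) h≤1) ⟩
      suc (d * 2 + 1)   ≡⟨ cong suc (+-comm (d * 2) 1) ⟩
      2 + d * 2         ∎

-- The binomial sum.

sumFromTo-suc : ∀ j f → sumFromTo 3 (3 + j) f ≡ sumFromTo 3 (2 + j) f + f (3 + j)
sumFromTo-suc j f = begin
  sum (map g (upTo (suc j)))               ≡⟨ cong (sum ∘ map g) (upTo-∷ʳ j) ⟨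
  sum (map g (upTo j ∷ʳ j))                ≡⟨ cong sum (map-++ g (upTo j) _) ⟩
  sum (map g (upTo j) ++ g j ∷ [])         ≡⟨ sum-++ (map g (upTo j)) _ ⟩
  sum (map g (upTo j)) + (g j + 0)         ≡⟨ cong (λ l → sum (map g (upTo j)) + l) (+-identityʳ (g j)) ⟩
  sum (map g (upTo j)) + g j               ∎
  where
  open ≡-Reasoning
  g : ℕ → ℕ
  g i = f (3 + i)

-- The new term is the right neighbour in row `j + 1` of the binomial already reached; Pascal's rule
-- adds them and symmetry moves the result to the lower central index.
central-sum : ∀ k → 1 + sumFromTo 3 (suc k) (λ m → (m ∸ 2) C ⌊ m /2⌋) ≡ k C ⌊ k /2⌋
central-sum 0 = refl
central-sum 1 = refl
central-sum (suc (suc j)) = begin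
  1 + sumFromTo 3 (3 + j) f                       ≡⟨ cong suc (sumFromTo-suc j f) ⟩
  1 + sumFromTo 3 (2 + j) f + f (3 + j)           ≡⟨ cong (λ l → l + f (3 + j)) (central-sum (suc j)) ⟩
  suc j C ⌈ j /2⌉ + suc j C suc ⌈ j /2⌉           ≡⟨ nCk+nC[k+1]≡[n+1]C[k+1] (suc j) ⌈ j /2⌉ ⟩
  suc (suc j) C suc ⌈ j /2⌉                       ≡⟨ subst (λ n → n C suc ⌊ j /2⌋ ≡ n C suc ⌈ j /2⌉)
                                                      (cong suc (trans (+-suc ⌊ j /2⌋ ⌈ j /2⌉) (cong suc (⌊n/2⌋+⌈n/2⌉≡n j))))
                                                      (C-sym (suc ⌊ j /2⌋) (suc ⌈ j /2⌉)) ⟨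
  suc (suc j) C suc ⌊ j /2⌋                       ∎
  where
  open ≡-Reasoning
  f : ℕ → ℕ
  f m = (m ∸ 2) C ⌊ m /2⌋

theorem1p8 : (∀ (S : FinSet) (m : ℤ) → Max S m →
    Admissible ⟦ S ⟧ ⇔ (Admissible (⟦ S ⟧ ∖ ｛ m ｝) × + (2 * ∣ S ∣) ℤ.< m))
    ×
    (∀ (m : ℕ) → 2 ≤ m →
    HasExactly ((m ∸ 2) C ⌊ m /2⌋) (λ S → Admissible ⟦ S ⟧ × Max S (+ m)))
    ×
    (∀ (n : ℕ) → 1 ≤ n →
    HasExactly (1 + sumFromTo 3 n (λ m → (m ∸ 2) C ⌊ m /2⌋)) (λ S → Admissible ⟦ S ⟧ × ⟦ S ⟧ ⊆ [1⋯ n ])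
    × 1 + sumFromTo 3 n (λ m → (m ∸ 2) C ⌊ m /2⌋) ≡ (n ∸ 1) C ⌊ n ∸ 1 /2⌋)
theorem1p8 = maximum-criterion , count-with-maximum , λ
  { (suc k) _ →
      subst (λ c → HasExactly c λ S → Admissible ⟦ S ⟧ × ⟦ S ⟧ ⊆ [1⋯ suc k ])
        (sym (central-sum k)) (count-in-interval k)
      , central-sum k }
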